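{- The longest cubefree word over the binary alphabet $\{0,1\}$ whose curling-number transform is overlap-free has length $13$. That is, there exists a cubefree binary word $x$ of length $13$ with $C(x)$ overlap-free, and there is no such word of length greater than $13$.
   Context: Words are indexed from $0$: a finite word of length $n$ is $x = x[0]x[1]\cdots x[n-1]$, and $x[i..j]$ denotes the factor (contiguous block) $x[i]\cdots x[j]$. A word is cubefree if it contains no factor of the form $yyy$ with $y$ a nonempty word. An overlap is a word of the form $a x a x a$ with $a$ a single letter and $x$ a possibly empty word; a word is overlap-free if it contains no overlap as a factor. The curling number of a nonempty finite word $u$ is the largest integer $k \ge 1$ such that $u = y z^k$ for some (possibly empty) word $y$ and some nonempty word $z$. For a finite or infinite word $x$, the curling-number transform $C(x)$ is the word over the positive integers, of the same length as $x$, whose $i$-th letter $C(x)[i]$ is the curling number of the prefix $x[0..i]$. -}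

module Defs where

open import Data.Fin.Base using (Fin; toℕ; fromℕ<)
open import Data.Fin.Properties using (any?; toℕ<n; toℕ-fromℕ<)
import Data.Fin.Properties as Fin
open import Data.List.Base
  using (List; []; _∷_; _++_; [_]; length; take; drop; replicate; concat; map; filter; upTo; tabulate; applyUpTo)
open import Data.List.Extrema.Nat using (max; argmax-sel; ⊥≤max; v≤max⁺)
open import Data.List.Membership.Propositional.Properties using (∈-map⁺; ∈-map⁻; ∈-filter⁺; ∈-filter⁻; ∈-upTo⁺)
open import Data.List.Properties using (length-++; length-drop; ++-assoc; ++-identityʳ)
open import Data.List.Relation.Binary.Infix.Heterogeneous using (Infix)
open import Data.List.Relation.Binary.Pointwise using (Pointwise-≡⇒≡; ≡⇒Pointwise-≡)
open import Data.List.Relation.Binary.Suffix.Heterogeneous as Suffix using (Suffix)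
open import Data.List.Relation.Binary.Suffix.Heterogeneous.Properties using (suffix?)
open import Data.List.Relation.Unary.Any as Any using ()
open import Data.Nat.Base using (ℕ; zero; suc; _+_; _≤_; _<_; z≤n; s≤s)
open import Data.Nat.Properties
  using (≤-trans; ≤-reflexive; +-mono-≤; m≤n+m; m<n⇒0<n∸m; <-irrefl; m<m+n)
open import Data.Product.Base using (∃-syntax; _×_; _,_; proj₁; proj₂)
open import Data.Sum.Base using (inj₁; inj₂)
open import Data.Unit.Base using (⊤)
open import Function.Base using (id)
open import Relation.Binary.Definitions using (DecidableEquality)
open import Relation.Binary.PropositionalEquality
  using (_≡_; _≢_; refl; sym; trans; cong; subst)
open import Relation.Nullary using (Dec; ¬_; contradiction)
open import Relation.Nullary.Decidable using (map′)

data Word (A : Set) : Set where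
  finite   : List A → Word A
  infinite : (ℕ → A) → Word A

_LongerThan_ : ∀ {A} → Word A → ℕ → Set
finite x   LongerThan n = n < length x
infinite _ LongerThan n = ⊤

_FactorOf_ : ∀ {A} → List A → Word A → Set
y FactorOf finite x   = Infix _≡_ y x
y FactorOf infinite x = ∃[ i ] y ≡ applyUpTo (λ j → x (i + j)) (length y)

Cubefree : ∀ {A} → Word A → Set
Cubefree x = ∀ y → y ≢ [] → ¬ ((y ++ y ++ y) FactorOf x)

OverlapFree : ∀ {A} → Word A → Set
OverlapFree w = ∀ a x → ¬ (([ a ] ++ x ++ [ a ] ++ x ++ [ a ]) FactorOf w)

pow : ∀ {A : Set} → List A → ℕ → List A
pow z k = concat (replicate k z)

EndsInPower : ∀ {A : Set} → List A → ℕ → Set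
EndsInPower u k = ∃[ y ] ∃[ z ] z ≢ [] × u ≡ y ++ pow z k

IsCurlingNumber : ∀ {A : Set} → List A → ℕ → Set
IsCurlingNumber u k = 1 ≤ k × EndsInPower u k × (∀ m → 1 ≤ m → EndsInPower u m → m ≤ k)

private
  nonempty : ∀ {A : Set} {z : List A} → z ≢ [] → 1 ≤ length z
  nonempty {z = []}    z≢[] = contradiction refl z≢[]
  nonempty {z = _ ∷ _} _    = s≤s z≤n

  drop-++ : ∀ {A : Set} (xs ys : List A) → drop (length xs) (xs ++ ys) ≡ ys
  drop-++ []       ys = refl
  drop-++ (_ ∷ xs) ys = drop-++ xs ys

  pow-suc : ∀ {A : Set} (z : List A) k → pow z (suc k) ≡ pow z k ++ z
  pow-suc z zero    = ++-identityʳ z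
  pow-suc z (suc k) = trans (cong (z ++_) (pow-suc z k)) (sym (++-assoc z (pow z k) z))

  length-pow : ∀ {A : Set} {z : List A} k → z ≢ [] → k ≤ length (pow z k)
  length-pow         zero    z≢[] = z≤n
  length-pow {z = z} (suc k) z≢[] =
    ≤-trans (+-mono-≤ (nonempty z≢[]) (length-pow k z≢[]))
            (≤-reflexive (sym (length-++ z)))

  exponent≤length : ∀ {A : Set} {u : List A} {k} → EndsInPower u k → k ≤ length u
  exponent≤length {k = k} (y , z , z≢[] , refl) =
    ≤-trans (length-pow k z≢[])
            (≤-trans (m≤n+m _ (length y)) (≤-reflexive (sym (length-++ y))))

module _ {A : Set} (_≟_ : DecidableEquality A) where

  -- A block z with u = y z^(k+1) is a nonempty suffix of u, so only suffixes are tried.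
  endsInPower? : (u : List A) (k : ℕ) → Dec (EndsInPower u (suc k))
  endsInPower? u k = map′ to from (any? {n = length u} λ i → suffix? _≟_ (pow (drop (toℕ i) u) (suc k)) u)
    where
    to : ∃[ i ] Suffix _≡_ (pow (drop (toℕ {length u} i) u) (suc k)) u → EndsInPower u (suc k)
    to (i , s) = proj₁ view , drop (toℕ i) u , drop≢[] , proj₂ view
      where
      suffix⇒++ : ∀ {p v : List A} → Suffix _≡_ p v → ∃[ y ] v ≡ y ++ p
      suffix⇒++ s with Suffix.toView s
      ... | y Suffix.++ rs = y , cong (y ++_) (sym (Pointwise-≡⇒≡ rs))
      view = suffix⇒++ s
      drop≢[] : drop (toℕ i) u ≢ []
      drop≢[] eq = <-irrefl (trans (cong length (sym eq)) (length-drop (toℕ i) u))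
                            (m<n⇒0<n∸m (toℕ<n i))

    from : EndsInPower u (suc k) → ∃[ i ] Suffix _≡_ (pow (drop (toℕ {length u} i) u) (suc k)) u
    from (y , z , z≢[] , u≡) = fromℕ< p< , subst (λ w → Suffix _≡_ (pow w (suc k)) u) (sym block)
                                                  (subst (Suffix _≡_ (pow z (suc k))) (sym u≡)
                                                    (y Suffix.++ˢ Suffix.here (≡⇒Pointwise-≡ refl)))
      where
      p : List A
      p = y ++ pow z k
      u≡p++z : u ≡ p ++ z
      u≡p++z = trans u≡ (trans (cong (y ++_) (pow-suc z k)) (sym (++-assoc y (pow z k) z)))
      p< : length p < length u
      p< = subst (length p <_) (sym (trans (cong length u≡p++z) (length-++ p)))
                 (m<m+n (length p) (nonempty z≢[]))
      block : drop (toℕ (fromℕ< p<)) u ≡ z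
      block = trans (cong (λ i → drop i u) (toℕ-fromℕ< p<))
                    (trans (cong (drop (length p)) u≡p++z) (drop-++ p z))

  -- The empty word has no curling number; it gets the junk value 1.
  curlingNumber : List A → ℕ
  curlingNumber u = max 1 (map suc (filter (endsInPower? u) (upTo (length u))))

  curlingNumber-correct : ∀ u → u ≢ [] → IsCurlingNumber u (curlingNumber u)
  curlingNumber-correct u u≢[] = ⊥≤max 1 ks , attained , maximal
    where
    ks : List ℕ
    ks = map suc (filter (endsInPower? u) (upTo (length u)))

    attained : EndsInPower u (max 1 ks)
    attained with argmax-sel id 1 ks
    ... | inj₁ eq = subst (EndsInPower u) (sym eq) ([] , u , u≢[] , sym (++-identityʳ u))
    ... | inj₂ m∈ with ∈-map⁻ suc m∈
    ...   | k , k∈ , eq = subst (EndsInPower u) (sym eq)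
                                (proj₂ (∈-filter⁻ (endsInPower? u) {xs = upTo (length u)} k∈))

    maximal : ∀ m → 1 ≤ m → EndsInPower u m → m ≤ max 1 ks
    maximal (suc k) _ e =
      v≤max⁺ 1 ks (inj₂ (Any.map ≤-reflexive
        (∈-map⁺ suc (∈-filter⁺ (endsInPower? u) (∈-upTo⁺ (exponent≤length e)) e))))

  transform : Word A → Word ℕ
  transform (finite x)   = finite (tabulate {n = length x} λ i → curlingNumber (take (suc (toℕ i)) x))
  transform (infinite x) = infinite λ i → curlingNumber (applyUpTo x (suc i))

C : Word (Fin 2) → Word ℕ
C = transform Fin._≟_

{-# OPTIONS --safe #-}
-- Cubefreeness of x and overlap-freeness of C(x) both pass to prefixes, so a
-- breadth-first search that extends the admissible words letter by letter
-- meets every admissible word. It dies out exactly at length 14.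
module Submission where

open import Defs
open import Data.Fin.Base using (Fin; toℕ)
open import Data.Fin.Patterns using (0F; 1F)
import Data.Fin.Properties as Fin
open import Data.List.Base
  using (List; []; _∷_; _∷ʳ_; _++_; [_]; length; take; drop; tabulate; applyUpTo; allFin; filter;
         cartesianProductWith; initLast; _∷ʳ′_)
open import Data.List.Membership.Propositional using (_∈_)
open import Data.List.Membership.Propositional.Properties
  using (∈-filter⁺; ∈-cartesianProductWith⁺; ∈-allFin)
open import Data.List.Properties using (length-take; length-applyUpTo; length-++; take++drop≡id)
open import Data.List.Relation.Binary.Infix.Heterogeneous using (Infix; here; there; _ⁱ++_)
open import Data.List.Relation.Binary.Prefix.Heterogeneous using (Prefix; []; _∷_)
open import Data.List.Relation.Binary.Prefix.Heterogeneous.Properties using (prefix?)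
open import Data.List.Relation.Unary.Any using (here)
open import Data.Nat.Base using (ℕ; zero; suc; _≤_; _<_; z≤n; s≤s)
open import Data.Nat.Properties using (_≟_; anyUpTo?; m≤n⇒m⊓n≡m; +-comm; suc-injective)
open import Data.Product.Base using (Σ-syntax; ∃-syntax; _×_; _,_)
open import Data.Sum.Base using (inj₁; inj₂; [_,_]′)
open import Function.Base using (_∘_)
open import Relation.Binary.Definitions using (DecidableEquality)
open import Relation.Binary.PropositionalEquality
  using (_≡_; refl; sym; trans; cong; subst)
open import Relation.Nullary using (Dec; no; ¬_; ¬?; _×-dec_; _⊎-dec_)
open import Relation.Nullary.Decidable using (map′; toWitness)

private
  variable
    A B : Set

prefixOf : ℕ → Word A → List A
prefixOf n (finite x)   = take n x
prefixOf n (infinite x) = applyUpTo x n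

length-prefixOf : ∀ n (w : Word A) → w LongerThan n → length (prefixOf (suc n) w) ≡ suc n
length-prefixOf n (finite x)   n<x = trans (length-take (suc n) x) (m≤n⇒m⊓n≡m n<x)
length-prefixOf n (infinite x) _   = length-applyUpTo x (suc n)

infix-take : ∀ n {y : List A} x → Infix _≡_ y (take n x) → Infix _≡_ y x
infix-take n x p = subst (Infix _≡_ _) (take++drop≡id n x) (p ⁱ++ drop n x)

prefix-applyUpTo : ∀ (x : ℕ → A) n {y} → Prefix _≡_ y (applyUpTo x n) → y ≡ applyUpTo x (length y)
prefix-applyUpTo x zero    []         = refl
prefix-applyUpTo x (suc n) []         = refl
prefix-applyUpTo x (suc n) (refl ∷ p) = cong (x 0 ∷_) (prefix-applyUpTo (x ∘ suc) n p)

infix-applyUpTo : ∀ (x : ℕ → A) n {y} → Infix _≡_ y (applyUpTo x n) → y FactorOf infinite x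
infix-applyUpTo x zero    (here p)  = 0 , prefix-applyUpTo x 0 p
infix-applyUpTo x (suc n) (here p)  = 0 , prefix-applyUpTo x (suc n) p
infix-applyUpTo x (suc n) (there p) with infix-applyUpTo (x ∘ suc) n p
... | i , eq = suc i , eq

factor-prefixOf : ∀ n {y : List A} w → y FactorOf finite (prefixOf n w) → y FactorOf w
factor-prefixOf n (finite x)   = infix-take n x
factor-prefixOf n (infinite x) = infix-applyUpTo x n

-- Stated for arbitrary `f` because the induction replaces `f` by `f ∘ (a ∷_)`: past the first
-- letter every prefix still begins with `a`, and `curlingNumber` alone would not be preserved by
-- this step.
tabulate-take : ∀ (f : List A → B) n x →
  tabulate {n = length (take n x)} (λ i → f (take (suc (toℕ i)) (take n x))) ≡
  take n (tabulate {n = length x} λ i → f (take (suc (toℕ i)) x))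
tabulate-take f zero    x       = refl
tabulate-take f (suc n) []      = refl
tabulate-take f (suc n) (a ∷ x) = cong (f [ a ] ∷_) (tabulate-take (f ∘ (a ∷_)) n x)

tabulate-applyUpTo : ∀ (f : List A → B) n (x : ℕ → A) →
  tabulate {n = length (applyUpTo x n)} (λ i → f (take (suc (toℕ i)) (applyUpTo x n))) ≡
  applyUpTo (λ i → f (applyUpTo x (suc i))) n
tabulate-applyUpTo f zero    x = refl
tabulate-applyUpTo f (suc n) x = cong (f [ x 0 ] ∷_) (tabulate-applyUpTo (f ∘ (x 0 ∷_)) n (x ∘ suc))

-- Each letter of the transform depends only on the prefix ending there, so truncation commutes with
-- it. This is what carries overlap-freeness of `C w` over to prefixes of `w`.
transform-prefixOf : ∀ (_≟_ : DecidableEquality A) n w →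
  transform _≟_ (finite (prefixOf n w)) ≡ finite (prefixOf n (transform _≟_ w))
transform-prefixOf _≟_ n (finite x)   = cong finite (tabulate-take (curlingNumber _≟_) n x)
transform-prefixOf _≟_ n (infinite x) = cong finite (tabulate-applyUpTo (curlingNumber _≟_) n x)

Admissible : Word (Fin 2) → Set
Admissible w = Cubefree w × OverlapFree (C w)

admissible-prefixOf : ∀ n w → Admissible w → Admissible (finite (prefixOf n w))
admissible-prefixOf n w (cubefree , overlapFree) =
  (λ y y≢[] → cubefree y y≢[] ∘ factor-prefixOf n w) ,
  subst OverlapFree (sym (transform-prefixOf Fin._≟_ n w))
        (λ a x → overlapFree a x ∘ factor-prefixOf n (C w))

-- Reduces the search for an unknown block to a bounded search for its length.
prefix-++⇒take : ∀ (x : List A) {y w} → Prefix _≡_ (x ++ y) w →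
                 length x ≤ length w × take (length x) w ≡ x
prefix-++⇒take []      _          = z≤n , refl
prefix-++⇒take (a ∷ x) (refl ∷ p) with prefix-++⇒take x p
... | le , eq = s≤s le , cong (a ∷_) eq

-- Cubes and overlaps are both words a x g(a, x), where x is read off the word
-- as soon as its length is chosen.
module _ (_≟_ : DecidableEquality A) (g : A → List A → List A) where

  startsWithPattern? : ∀ w → Dec (∃[ a ] ∃[ x ] Prefix _≡_ (a ∷ x ++ g a x) w)
  startsWithPattern? []      = no λ ()
  startsWithPattern? (a ∷ w) =
    map′ (λ (n , _ , p) → a , take n w , refl ∷ p) from
         -- The bound is strict, so `suc` admits `n` up to `length w` inclusive.
         (anyUpTo? (λ n → prefix? _≟_ (take n w ++ g a (take n w)) w) (suc (length w)))
    where
    from : ∃[ b ] ∃[ x ] Prefix _≡_ (b ∷ x ++ g b x) (a ∷ w) →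
           ∃[ n ] n < suc (length w) × Prefix _≡_ (take n w ++ g a (take n w)) w
    from (_ , x , refl ∷ p) with prefix-++⇒take x p
    ... | le , eq = length x , s≤s le , subst (λ x → Prefix _≡_ (x ++ g a x) w) (sym eq) p

  containsPattern? : ∀ w → Dec (∃[ a ] ∃[ x ] Infix _≡_ (a ∷ x ++ g a x) w)
  containsPattern? []      = no λ { (_ , _ , here ()) }
  containsPattern? (b ∷ w) =
    map′ [ (λ (a , x , p) → a , x , here p) , (λ (a , x , p) → a , x , there p) ]′
         (λ { (a , x , here p) → inj₁ (a , x , p) ; (a , x , there p) → inj₂ (a , x , p) })
         (startsWithPattern? (b ∷ w) ⊎-dec containsPattern? w)

-- Splitting the repeated block into head and tail builds in its nonemptiness, and makes the cube
-- definitionally an instance of the pattern.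
cubefree? : DecidableEquality A → (x : List A) → Dec (Cubefree (finite x))
cubefree? _≟_ x =
  map′ (λ { ¬cube []      y≢[] _ → y≢[] refl
          ; ¬cube (a ∷ y) _    p → ¬cube (a , y , p) })
       (λ cubefree (a , y , p) → cubefree (a ∷ y) (λ ()) p)
       (¬? (containsPattern? _≟_ (λ a y → (a ∷ y) ++ (a ∷ y)) x))

overlapFree? : DecidableEquality A → (x : List A) → Dec (OverlapFree (finite x))
overlapFree? _≟_ x =
  map′ (λ ¬overlap a y p → ¬overlap (a , y , p))
       (λ overlapFree (a , y , p) → overlapFree a y p)
       (¬? (containsPattern? _≟_ (λ a y → [ a ] ++ y ++ [ a ]) x))

admissible? : (x : List (Fin 2)) → Dec (Admissible (finite x))
-- The omitted list is the one that `C (finite x)` unfolds to; its letters are naturals, hence the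
-- second equality test.
admissible? x = cubefree? Fin._≟_ x ×-dec overlapFree? _≟_ _

-- Words grow on the right, which leaves the earlier letters of the transform fixed; a letter added
-- on the left could change them.
admissibleWords : ℕ → List (List (Fin 2))
admissibleWords zero    = [ [] ]
admissibleWords (suc n) = filter admissible? (cartesianProductWith _∷ʳ_ (admissibleWords n) (allFin 2))

take-length-++ : ∀ (x y : List A) → take (length x) (x ++ y) ≡ x
take-length-++ []      y = refl
take-length-++ (a ∷ x) y = cong (a ∷_) (take-length-++ x y)

-- Completeness of the search: deleting the last letter leaves an admissible prefix, which the
-- previous level contains by induction.
∈-admissibleWords : ∀ n {x} → length x ≡ n → Admissible (finite x) → x ∈ admissibleWords n
∈-admissibleWords zero    {[]} _  _   = here refl
∈-admissibleWords (suc n) {x}  eq adm with initLast x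
... | p ∷ʳ′ a = ∈-filter⁺ admissible? (∈-cartesianProductWith⁺ _∷ʳ_ p∈ (∈-allFin a)) adm
  where
  p∈ : p ∈ admissibleWords n
  p∈ = ∈-admissibleWords n
    (suc-injective (trans (+-comm 1 (length p)) (trans (sym (length-++ p)) eq)))
    (subst (Admissible ∘ finite) (take-length-++ p [ a ])
           (admissible-prefixOf (length p) (finite (p ∷ʳ a)) adm))

-- Holds by evaluation: type checking runs the whole search.
admissibleWords-14 : admissibleWords 14 ≡ []
admissibleWords-14 = refl

-- This is the square of 011010 followed by 0. It is itself an overlap, but its transform
-- 1121122121122 is overlap-free.
word₁₃ : List (Fin 2)
word₁₃ = 0F ∷ 1F ∷ 1F ∷ 0F ∷ 1F ∷ 0F ∷ 0F ∷ 1F ∷ 1F ∷ 0F ∷ 1F ∷ 0F ∷ 0F ∷ []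

theorem4 : (Σ[ x ∈ List (Fin 2) ] length x ≡ 13 × Cubefree (finite x) × OverlapFree (C (finite x)))
    × (∀ (x : Word (Fin 2)) → x LongerThan 13 → ¬ (Cubefree x × OverlapFree (C x)))
theorem4 = (word₁₃ , refl , toWitness {a? = admissible? word₁₃} _) , tooLong
  where
  tooLong : ∀ x → x LongerThan 13 → ¬ Admissible x
  tooLong x long adm
    -- A word longer than 13, finite or infinite, has a prefix of length exactly 14, which would
    -- have to lie in the empty level.
    with () ← subst (prefixOf 14 x ∈_) admissibleWords-14
                (∈-admissibleWords 14 (length-prefixOf 13 x long) (admissible-prefixOf 14 x adm))
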